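{- Let $n\in\mathbb{N}$ and let $G=K_{2,n}$ be the complete bipartite graph with partite sets of sizes $2$ and $n$. Then for every integer $t\ge\chi_\ell(G)$ (the domain of the list epsilon flexibility function $\epsilon_\ell(G,\cdot)$), $$\epsilon_{\ell}(G,t)=\begin{cases}1/2 & \text{if } n=1 \text{ and } t\ge 2,\\ 0 & \text{if } n\in\{2,3\}\text{ and } t=2,\\ 1/2 & \text{otherwise.}\end{cases}$$
   Context: All graphs are nonempty, finite and simple; $\mathbb{N}=\{1,2,3,\ldots\}$. A list assignment $L$ for a graph $G$ assigns to each vertex $v$ a set $L(v)$ of colors; it is a $k$-assignment if $|L(v)|=k$ for every $v\in V(G)$. A proper $L$-coloring of $G$ is a proper coloring $f$ of $G$ with $f(v)\in L(v)$ for every $v\in V(G)$. The list chromatic number $\chi_\ell(G)$ is the smallest $k$ such that $G$ has a proper $L$-coloring for every $k$-assignment $L$ for $G$. A request of $L$ is a function $r$ with nonempty domain $D\subseteq V(G)$ such that $r(v)\in L(v)$ for each $v\in D$. For $\epsilon\in[0,1]$, the triple $(G,L,r)$ is $\epsilon$-satisfiable if there is a proper $L$-coloring $f$ of $G$ with $f(v)=r(v)$ for at least $\epsilon|D|$ vertices $v\in D$. The graph $G$ is $(k,\epsilon)$-flexible if $(G,L,r)$ is $\epsilon$-satisfiable for every $k$-assignment $L$ for $G$ and every request $r$ of $L$. The list epsilon flexibility function of $G$ maps each integer $t\ge\chi_\ell(G)$ to $\epsilon_\ell(G,t)$, the largest $\epsilon\in[0,1]$ such that $G$ is $(t,\epsilon)$-flexible.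 -}

module Defs where

open import Data.Empty using (⊥)
open import Data.Fin.Base using (Fin; splitAt)
open import Data.Fin.Subset using (Subset; ∣_∣; Nonempty)
open import Data.Integer.Base as ℤ using ()
open import Data.List.Base using (List; length)
open import Data.List.Membership.Propositional using (_∈_)
open import Data.List.Relation.Unary.Unique.Propositional using (Unique)
open import Data.Maybe.Base using (Maybe; just; is-just)
import Data.Maybe.Properties as Maybe
open import Data.Nat.Base as ℕ using (ℕ; NonZero)
import Data.Nat.Properties as ℕ
open import Data.Product.Base using (Σ; ∃; ∃-syntax; _×_; _,_; proj₁)
open import Data.Rational.Base as ℚ using (ℚ; 0ℚ; 1ℚ)
import Data.Rational.Properties as ℚ
open import Data.Sum.Base using (_⊎_; inj₁; inj₂)
open import Data.Unit.Base using (⊤; tt)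
open import Data.Vec.Base using (tabulate)
open import Level using (0ℓ)
open import Relation.Binary.Core using (Rel)
open import Relation.Binary.Definitions using (Decidable; Symmetric; Irreflexive)
open import Relation.Binary.PropositionalEquality using (_≡_; _≢_; refl; subst)
open import Relation.Nullary using (¬_; yes; no; does)

------------------------------------------------------------------------
-- Dedekind reals

record ℝ : Set₁ where
  field
    lower upper  : ℚ → Set
    lower-inhab  : ∃ lower
    upper-inhab  : ∃ upper
    lower-closed : ∀ {p q} → p ℚ.< q → lower q → lower p
    upper-closed : ∀ {p q} → p ℚ.< q → upper p → upper q
    lower-open   : ∀ {p} → lower p → ∃[ q ] (p ℚ.< q × lower q)
    upper-open   : ∀ {q} → upper q → ∃[ p ] (p ℚ.< q × upper p)
    disjoint     : ∀ {q} → ¬ (lower q × upper q)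
    located      : ∀ {p q} → p ℚ.< q → lower p ⊎ upper q

open ℝ public

infix 4 _≤ᴿ_

_≤ᴿ_ : ℝ → ℝ → Set
x ≤ᴿ y = ∀ q → lower x q → lower y q

private
  0<1 : 0ℚ ℚ.< 1ℚ
  0<1 = ℚ.positive⁻¹ 1ℚ

  -1<0 : ℚ.- 1ℚ ℚ.< 0ℚ
  -1<0 = ℚ.negative⁻¹ (ℚ.- 1ℚ)

fromℚ : ℚ → ℝ
fromℚ p = record
  { lower        = ℚ._< p
  ; upper        = p ℚ.<_
  ; lower-inhab  = p ℚ.+ ℚ.- 1ℚ
                 , subst (p ℚ.+ ℚ.- 1ℚ ℚ.<_) (ℚ.+-identityʳ p) (ℚ.+-monoʳ-< p -1<0)
  ; upper-inhab  = p ℚ.+ 1ℚ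
                 , subst (ℚ._< p ℚ.+ 1ℚ) (ℚ.+-identityʳ p) (ℚ.+-monoʳ-< p 0<1)
  ; lower-closed = ℚ.<-trans
  ; upper-closed = λ q<r p<q → ℚ.<-trans p<q q<r
  ; lower-open   = λ q<p → let r , q<r , r<p = ℚ.<-dense q<p in r , q<r , r<p
  ; upper-open   = λ p<q → let r , p<r , r<q = ℚ.<-dense p<q in r , r<q , p<r
  ; disjoint     = λ (q<p , p<q) → ℚ.<-asym q<p p<q
  ; located      = loc
  }
  where
  loc : ∀ {q r} → q ℚ.< r → q ℚ.< p ⊎ p ℚ.< r
  loc {q} q<r with q ℚ.<? p
  ... | yes q<p = inj₁ q<p
  ... | no  q≮p = inj₂ (ℚ.≤-<-trans (ℚ.≮⇒≥ q≮p) q<r)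

fromℕ : ℕ → ℚ
fromℕ m = ℤ.+ m ℚ./ 1

-- The inequality x · d ≤ m: as d ≥ 0, the real x · d is the supremum of the
-- q · d over rationals q < x.
infix 4 _·_≤_

_·_≤_ : ℝ → ℕ → ℕ → Set
x · d ≤ m = ∀ q → lower x q → q ℚ.* fromℕ d ℚ.≤ fromℕ m

InUnitInterval : ℝ → Set
InUnitInterval ε = fromℚ 0ℚ ≤ᴿ ε × ε ≤ᴿ fromℚ 1ℚ

------------------------------------------------------------------------
-- Nonempty finite simple graphs

record Graph : Set₁ where
  field
    order    : ℕ
    nonempty : NonZero order
    Adj      : Rel (Fin order) 0ℓ
    adj?     : Decidable Adj
    sym      : Symmetric Adj
    irrefl   : Irreflexive _≡_ Adj

  V : Set
  V = Fin order

open Graph public using (order; V; Adj)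

module _ {A B : Set} where

  OppositeSides : Rel (A ⊎ B) 0ℓ
  OppositeSides (inj₁ _) (inj₁ _) = ⊥
  OppositeSides (inj₁ _) (inj₂ _) = ⊤
  OppositeSides (inj₂ _) (inj₁ _) = ⊤
  OppositeSides (inj₂ _) (inj₂ _) = ⊥

  oppositeSides? : Decidable OppositeSides
  oppositeSides? (inj₁ _) (inj₁ _) = no λ ()
  oppositeSides? (inj₁ _) (inj₂ _) = yes tt
  oppositeSides? (inj₂ _) (inj₁ _) = yes tt
  oppositeSides? (inj₂ _) (inj₂ _) = no λ ()

  oppositeSides-sym : Symmetric OppositeSides
  oppositeSides-sym {inj₁ _} {inj₂ _} _ = tt
  oppositeSides-sym {inj₂ _} {inj₁ _} _ = tt

  oppositeSides-irrefl : ∀ s → ¬ OppositeSides s s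
  oppositeSides-irrefl (inj₁ _) ()
  oppositeSides-irrefl (inj₂ _) ()

-- The complete bipartite graph: the first m vertices form one partite set,
-- the remaining n the other.
K : (m n : ℕ) .{{_ : NonZero m}} .{{_ : NonZero n}} → Graph
K m n = record
  { order    = m ℕ.+ n
  ; nonempty = ℕ.>-nonZero (ℕ.<-≤-trans (ℕ.>-nonZero⁻¹ m) (ℕ.m≤m+n m n))
  ; Adj      = λ u v → OppositeSides (splitAt m u) (splitAt m v)
  ; adj?     = λ u v → oppositeSides? (splitAt m u) (splitAt m v)
  ; sym      = λ {u} {v} → oppositeSides-sym {x = splitAt m u} {splitAt m v}
  ; irrefl   = λ { {u} refl → oppositeSides-irrefl (splitAt m u) }
  }

------------------------------------------------------------------------
-- List colouring

-- Colours are natural numbers; a finite set of colours is a repetition-free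
-- list, so that its length is its cardinality.
ColourSet : Set
ColourSet = Σ (List ℕ) Unique

infix 4 _∈ᶜ_

_∈ᶜ_ : ℕ → ColourSet → Set
c ∈ᶜ C = c ∈ proj₁ C

size : ColourSet → ℕ
size C = length (proj₁ C)

ListAssignment : Graph → Set
ListAssignment G = V G → ColourSet

IsAssignmentOfSize : (G : Graph) → ℕ → ListAssignment G → Set
IsAssignmentOfSize G k L = ∀ v → size (L v) ≡ k

IsProperListColouring : (G : Graph) → ListAssignment G → (V G → ℕ) → Set
IsProperListColouring G L f =
  (∀ v → f v ∈ᶜ L v) × (∀ u v → Adj G u v → f u ≢ f v)

IsChoosable : Graph → ℕ → Set
IsChoosable G k =
  ∀ L → IsAssignmentOfSize G k L → ∃[ f ] IsProperListColouring G L f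

IsListChromaticNumber : Graph → ℕ → Set
IsListChromaticNumber G k =
  IsChoosable G k × (∀ j → IsChoosable G j → k ℕ.≤ j)

------------------------------------------------------------------------
-- Requests and flexibility

PartialColouring : Graph → Set
PartialColouring G = V G → Maybe ℕ

domain : (G : Graph) → PartialColouring G → Subset (order G)
domain G r = tabulate (λ v → is-just (r v))

IsRequest : (G : Graph) → ListAssignment G → PartialColouring G → Set
IsRequest G L r =
  Nonempty (domain G r) × (∀ v c → r v ≡ just c → c ∈ᶜ L v)

honoured : (G : Graph) → PartialColouring G → (V G → ℕ) → Subset (order G)
honoured G r f = tabulate (λ v → does (Maybe.≡-dec ℕ._≟_ (r v) (just (f v))))

IsSatisfiable : (G : Graph) → ℝ → ListAssignment G → PartialColouring G → Set
IsSatisfiable G ε L r =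
  ∃[ f ] (IsProperListColouring G L f × ε · ∣ domain G r ∣ ≤ ∣ honoured G r f ∣)

IsFlexible : Graph → ℕ → ℝ → Set
IsFlexible G k ε =
  ∀ L → IsAssignmentOfSize G k L → ∀ r → IsRequest G L r → IsSatisfiable G ε L r

-- ε is the value at t of the list epsilon flexibility function of G.
IsListEpsilonFlexibility : Graph → ℕ → ℝ → Set₁
IsListEpsilonFlexibility G t ε =
  InUnitInterval ε × IsFlexible G t ε ×
  (∀ ε′ → InUnitInterval ε′ → IsFlexible G t ε′ → ε′ ≤ᴿ ε)

{-# OPTIONS --safe #-}
module Submission where

-- Two proper colourings that together honour every request show that one of
-- them honours at least half of it.  In K₂,ₙ with lists of size at least 3, give
-- x₁, x₂ first their requested colours a, b and then colours a′, b′ outside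
-- {a, b}: each yᵢ has a colour left both times, and its requested colour is
-- unavailable at most once.  On the path K₂,₁ two different colours of the
-- centre suffice.  No more than half is possible when the ends of an edge
-- request the same colour.  The lists {0,1}, {2,3} on x₁, x₂ and {0,2}, {0,3} on
-- y₀, y₁ rule out the colour 0 at x₁; adding {1,2}, {1,3} also rules out 1, so
-- that K₂,ₙ is not 2-choosable for n ≥ 4.

open import Defs
open import Data.Bool.Base using (if_then_else_; _∧_; _∨_)
open import Data.Nat.Base using (ℕ; NonZero; _≤_; _≡ᵇ_; _≤ᵇ_)
open import Data.Rational.Base using (0ℚ; ½)

open import Data.Bool.Base using (Bool; true; false)
open import Data.Fin.Base using (Fin; zero; suc)
open import Data.Fin.Subset using (Subset; ∣_∣; _∪_; _⊆_; inside; outside)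
  renaming (_∈_ to _∈ˢ_)
open import Data.Fin.Subset.Properties using (p⊆q⇒∣p∣≤∣q∣; x∈p∪q⁺)
import Data.Integer.Base as ℤ
import Data.Integer.Properties as ℤ
open import Data.List.Base using (List; []; _∷_; length; take; upTo)
open import Data.List.Membership.Propositional using (_∈_; _∉_)
open import Data.List.Membership.Propositional.Properties using (∈-filter⁺; ∈-upTo⁺)
open import Data.List.Properties using (filter-notAll; length-take; length-upTo)
open import Data.List.Relation.Binary.Sublist.Propositional using () renaming (lookup to ⊆-lookup)
open import Data.List.Relation.Binary.Sublist.Propositional.Properties using (take-⊆)
open import Data.List.Relation.Unary.All using ([]; _∷_) renaming (lookup to All-lookup)
open import Data.List.Relation.Unary.AllPairs using ([]; _∷_)
open import Data.List.Relation.Unary.Any as Any using (here; there)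
open import Data.List.Relation.Unary.Unique.Propositional using (Unique)
open import Data.List.Relation.Unary.Unique.Propositional.Properties using (take⁺; upTo⁺)
open import Data.Maybe.Base using (Maybe; just; nothing; is-just)
import Data.Maybe.Properties as Maybe
open import Data.Nat.Base using (zero; suc; _+_; _<_; z≤n; s≤s)
open import Data.Nat.Properties
  using (_≟_; _≤?_; ≤-refl; ≤-trans; ≤-reflexive; ≤-total; ≰⇒>; <-≤-trans; m≤n⇒m≤1+n;
         m≤n⇒m⊓n≡m; +-monoˡ-≤; +-monoʳ-≤; +-suc; *-comm; +-identityʳ)
open import Data.List.Membership.DecPropositional _≟_ using (_∈?_)
open import Data.Product.Base using (∃; ∃-syntax; _×_; _,_; proj₁; proj₂)
import Data.Rational.Base as ℚ
import Data.Rational.Properties as ℚ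
import Data.Rational.Unnormalised.Base as ℚᵘ
import Data.Rational.Unnormalised.Properties as ℚᵘ
open import Data.Sum.Base using (_⊎_; inj₁; inj₂)
open import Data.Empty using (⊥)
open import Data.Unit.Base using (tt)
open import Data.Vec.Base using ([]; _∷_; tabulate; here)
open import Data.Vec.Properties using ([]=⇒lookup; lookup⇒[]=; lookup∘tabulate)
open import Function.Base using (_∘_)
open import Relation.Binary.PropositionalEquality
  using (_≡_; _≢_; refl; sym; trans; cong; subst; subst₂)
open import Relation.Nullary using (¬_; yes; no; contradiction; ¬?)
open import Relation.Nullary.Decidable using (dec-true)

-- Inequalities between reals and multiples of natural numbers.

0·d≤m : ∀ d m → fromℚ 0ℚ · d ≤ m
0·d≤m d m q q<0 = begin
  q ℚ.* fromℕ d   ≤⟨ ℚ.*-monoʳ-≤-nonNeg (fromℕ d) ⦃ ℚ.normalize-nonNeg d 1 ⦄ (ℚ.<⇒≤ q<0) ⟩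
  0ℚ ℚ.* fromℕ d  ≡⟨ ℚ.*-zeroˡ (fromℕ d) ⟩
  0ℚ              ≤⟨ ℚ.nonNegative⁻¹ (fromℕ m) ⦃ ℚ.normalize-nonNeg m 1 ⦄ ⟩
  fromℕ m         ∎
  where open ℚ.≤-Reasoning

-- Any `q < ½` gives `q * d ≤ ½ * d`, so only a rational inequality remains; it is checked on
-- unnormalised fractions, where it becomes one of integers.
d≤m+m⇒½·d≤m : ∀ d m → d ≤ m + m → fromℚ ½ · d ≤ m
d≤m+m⇒½·d≤m d m d≤m+m q q<½ =
  ℚ.≤-trans (ℚ.*-monoʳ-≤-nonNeg (fromℕ d) ⦃ ℚ.normalize-nonNeg d 1 ⦄ (ℚ.<⇒≤ q<½))
            (ℚ.toℚᵘ-cancel-≤ ½d≤m)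
  where
  fromℕᵘ : ℕ → ℚᵘ.ℚᵘ
  fromℕᵘ k = ℚᵘ.mkℚᵘ (ℤ.+ k) 0

  toℚᵘ-fromℕ : ∀ k → ℚ.toℚᵘ (fromℕ k) ℚᵘ.≃ fromℕᵘ k
  toℚᵘ-fromℕ k = ℚ.toℚᵘ-fromℚᵘ (fromℕᵘ k)

  -- This is `½ * d ≤ m` cross-multiplied by the denominators 1 and 2.
  cleared : (ℤ.1ℤ ℤ.* ℤ.+ d) ℤ.* ℤ.1ℤ ℤ.≤ ℤ.+ m ℤ.* ℤ.+ 2
  cleared rewrite ℤ.*-identityʳ (ℤ.1ℤ ℤ.* ℤ.+ d) | ℤ.*-identityˡ (ℤ.+ d)
                | sym (ℤ.pos-* m 2) | *-comm m 2 | +-identityʳ m = ℤ.+≤+ d≤m+m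

  open ℚᵘ.≤-Reasoning
  ½d≤m : ℚ.toℚᵘ (½ ℚ.* fromℕ d) ℚᵘ.≤ ℚ.toℚᵘ (fromℕ m)
  ½d≤m = begin
    ℚ.toℚᵘ (½ ℚ.* fromℕ d)       ≃⟨ ℚ.toℚᵘ-homo-* ½ (fromℕ d) ⟩
    ℚᵘ.½ ℚᵘ.* ℚ.toℚᵘ (fromℕ d)   ≃⟨ ℚᵘ.*-congˡ {ℚᵘ.½} (toℚᵘ-fromℕ d) ⟩
    ℚᵘ.½ ℚᵘ.* fromℕᵘ d           ≤⟨ ℚᵘ.*≤* cleared ⟩
    fromℕᵘ m                     ≃⟨ toℚᵘ-fromℕ m ⟨
    ℚ.toℚᵘ (fromℕ m)             ∎

-- Cancelling `d` alone gives only a weak inequality, while membership in the lower cut of `p` is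
-- strict. Openness supplies a larger `q′` still below `x`, and `q < q′ ≤ p`.
·≤⇒≤ᴿ : ∀ {x d m} p .{{_ : ℚ.Positive (fromℕ d)}} →
        fromℕ m ℚ.≤ p ℚ.* fromℕ d → x · d ≤ m → x ≤ᴿ fromℚ p
·≤⇒≤ᴿ {x} {d} p m≤pd xd≤m q q∈x with lower-open x q∈x
... | q′ , q<q′ , q′∈x =
  ℚ.<-≤-trans q<q′ (ℚ.*-cancelʳ-≤-pos (fromℕ d) (ℚ.≤-trans (xd≤m q′ q′∈x) m≤pd))

·1≤0⇒≤0 : ∀ {x} → x · 1 ≤ 0 → x ≤ᴿ fromℚ 0ℚ
·1≤0⇒≤0 {x} = ·≤⇒≤ᴿ {x} {1} {0} 0ℚ ℚ.≤-refl

·2≤1⇒≤½ : ∀ {x m} → m ≤ 1 → x · 2 ≤ m → x ≤ᴿ fromℚ ½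
·2≤1⇒≤½ {x} z≤n       = ·≤⇒≤ᴿ {x} {2} {0} ½ (ℚ.nonNegative⁻¹ ℚ.1ℚ)
·2≤1⇒≤½ {x} (s≤s z≤n) = ·≤⇒≤ᴿ {x} {2} {1} ½ ℚ.≤-refl

0∈[0,1] : InUnitInterval (fromℚ 0ℚ)
0∈[0,1] = (λ _ q<0 → q<0) , λ _ q<0 → ℚ.<-trans q<0 (ℚ.positive⁻¹ ℚ.1ℚ)

½∈[0,1] : InUnitInterval (fromℚ ½)
½∈[0,1] = (λ _ q<0 → ℚ.<-trans q<0 (ℚ.positive⁻¹ ½))
        , (λ _ q<½ → ℚ.<-trans q<½ (ℚ.*<* (ℤ.+<+ (s≤s (s≤s z≤n)))))

-- Cardinalities and membership of finite subsets.

∣p∪q∣≤∣p∣+∣q∣ : ∀ {n} (p q : Subset n) → ∣ p ∪ q ∣ ≤ ∣ p ∣ + ∣ q ∣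
∣p∪q∣≤∣p∣+∣q∣ []            []            = z≤n
∣p∪q∣≤∣p∣+∣q∣ (outside ∷ p) (outside ∷ q) = ∣p∪q∣≤∣p∣+∣q∣ p q
∣p∪q∣≤∣p∣+∣q∣ (outside ∷ p) (inside  ∷ q) =
  ≤-trans (s≤s (∣p∪q∣≤∣p∣+∣q∣ p q)) (≤-reflexive (sym (+-suc ∣ p ∣ ∣ q ∣)))
∣p∪q∣≤∣p∣+∣q∣ (inside  ∷ p) (outside ∷ q) = s≤s (∣p∪q∣≤∣p∣+∣q∣ p q)
∣p∪q∣≤∣p∣+∣q∣ (inside  ∷ p) (inside  ∷ q) =
  s≤s (≤-trans (∣p∪q∣≤∣p∣+∣q∣ p q) (+-monoʳ-≤ ∣ p ∣ (m≤n⇒m≤1+n ≤-refl)))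

∈-tabulate⁺ : ∀ {n} (f : Fin n → Bool) {i} → f i ≡ true → i ∈ˢ tabulate f
∈-tabulate⁺ f {i} fi = lookup⇒[]= i _ (trans (lookup∘tabulate f i) fi)

∈-tabulate⁻ : ∀ {n} (f : Fin n → Bool) {i} → i ∈ˢ tabulate f → f i ≡ true
∈-tabulate⁻ f {i} i∈ = trans (sym (lookup∘tabulate f i)) ([]=⇒lookup i∈)

∣tabulate-false∣≡0 : ∀ n → ∣ tabulate {n = n} (λ _ → false) ∣ ≡ 0
∣tabulate-false∣≡0 zero    = refl
∣tabulate-false∣≡0 (suc n) = ∣tabulate-false∣≡0 n

-- Choosing colours outside a short list.

-- Pigeonhole by induction on `xs`: a head that lies in `ys` is filtered out of `ys`, which shortens
-- it. The colour then found in the tail differs from the head, so the filtering did not hide it.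
unique⇒∃∉ : ∀ {xs ys : List ℕ} → Unique xs → length ys < length xs → ∃[ c ] (c ∈ xs × c ∉ ys)
unique⇒∃∉ {x ∷ xs} {ys} (x∉xs ∷ uniq) (s≤s ∣ys∣≤∣xs∣) with x ∈? ys
... | no  x∉ys = x , here refl , x∉ys
... | yes x∈ys =
  let ≢x?          = λ y → ¬? (y ≟ x)
      ∣ys′∣<∣ys∣   = filter-notAll ≢x? ys (Any.map (λ x≡y y≢x → y≢x (sym x≡y)) x∈ys)
      c , c∈ , c∉  = unique⇒∃∉ uniq (<-≤-trans ∣ys′∣<∣ys∣ ∣ys∣≤∣xs∣)
  in c , there c∈ , λ c∈ys → c∉ (∈-filter⁺ ≢x? c∈ys (All-lookup x∉xs c∈ ∘ sym))

avoiding : ∀ C ys → length ys < size C → ∃[ c ] (c ∈ᶜ C × c ∉ ys)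
avoiding (_ , uniq) ys = unique⇒∃∉ uniq

-- Here `ys` holds the colours taken by the neighbours and `m` the possible request at the vertex,
-- which may be refused only because of `ys`.
BestChoice : ColourSet → List ℕ → Maybe ℕ → ℕ → Set
BestChoice C ys m c = c ∈ᶜ C × c ∉ ys × (∀ k → m ≡ just k → k ∉ ys → c ≡ k)

preferring : ∀ C ys → length ys < size C → ∀ m → (∀ k → m ≡ just k → k ∈ᶜ C) →
             ∃ (BestChoice C ys m)
preferring C ys ys<C nothing  _   = let c , c∈ , c∉ = avoiding C ys ys<C in c , c∈ , c∉ , λ _ ()
preferring C ys ys<C (just k) m∈C with k ∈? ys
... | no  k∉ = k , m∈C k refl , k∉ , λ _ m≡ _ → Maybe.just-injective m≡
... | yes k∈ = let c , c∈ , c∉ = avoiding C ys ys<C in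
  c , c∈ , c∉ , λ { _ refl k∉ → contradiction k∈ k∉ }

-- A requested colour that is not forbidden both times is chosen at least once.
bestChoices-joint : ∀ C {m k us vs} (p : ∃ (BestChoice C us m)) (q : ∃ (BestChoice C vs m)) →
                    (k ∈ us → k ∉ vs) → m ≡ just k → proj₁ p ≡ k ⊎ proj₁ q ≡ k
bestChoices-joint _ {k = k} {us} (_ , _ , _ , p-pref) (_ , _ , _ , q-pref) disjoint m≡k with k ∈? us
... | no  k∉us = inj₁ (p-pref k m≡k k∉us)
... | yes k∈us = inj₂ (q-pref k m≡k (disjoint k∈us))

-- Choosability and satisfiability in arbitrary graphs.

module _ (G : Graph) where

  -- Each list can be truncated to its first `k` colours.
  choosable-mono : ∀ {k t} → k ≤ t → IsChoosable G k → IsChoosable G t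
  choosable-mono {k} k≤t choosable L ∣L∣≡t =
    let f , f∈ , proper = choosable
          (λ v → take k (proj₁ (L v)) , take⁺ k (proj₂ (L v)))
          (λ v → trans (length-take k (proj₁ (L v)))
                       (m≤n⇒m⊓n≡m (≤-trans k≤t (≤-reflexive (sym (∣L∣≡t v))))))
    in f , (λ v → ⊆-lookup (take-⊆ k (proj₁ (L v))) (f∈ v)) , proper

  ¬choosable⇒< : ∀ {k t} → IsChoosable G t → ¬ IsChoosable G k → k < t
  ¬choosable⇒< {k} {t} choosable ¬choosable with t ≤? k
  ... | yes t≤k = contradiction (choosable-mono t≤k choosable) ¬choosable
  ... | no  t≰k = ≰⇒> t≰k

  choosable⇒0-flexible : ∀ {t} → IsChoosable G t → IsFlexible G t (fromℚ 0ℚ)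
  choosable⇒0-flexible choosable L ∣L∣≡t r _ =
    let f , proper = choosable L ∣L∣≡t in f , proper , 0·d≤m ∣ domain G r ∣ ∣ honoured G r f ∣

  -- The two honoured sets cover the domain of the request, so the larger has at least half its
  -- size.
  jointlyHonoured⇒½-satisfiable : ∀ L r {f g} →
    IsProperListColouring G L f → IsProperListColouring G L g →
    (∀ v k → r v ≡ just k → f v ≡ k ⊎ g v ≡ k) → IsSatisfiable G (fromℚ ½) L r
  jointlyHonoured⇒½-satisfiable L r {f} {g} f-proper g-proper joint =
    [f]or[g] (≤-total ∣ honoured G r g ∣ ∣ honoured G r f ∣)
    where
    honours : ∀ h {v k} → r v ≡ just k → h v ≡ k → v ∈ˢ honoured G r h
    honours h {v} rv≡k hv≡k = ∈-tabulate⁺ _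
      (dec-true (Maybe.≡-dec _≟_ (r v) (just (h v))) (trans rv≡k (cong just (sym hv≡k))))

    covered : domain G r ⊆ honoured G r f ∪ honoured G r g
    covered {v} v∈ with r v in rv | ∈-tabulate⁻ (is-just ∘ r) v∈
    ... | nothing | ()
    ... | just k  | _ with joint v k rv
    ...   | inj₁ fv≡k = x∈p∪q⁺ (inj₁ (honours f rv fv≡k))
    ...   | inj₂ gv≡k = x∈p∪q⁺ (inj₂ (honours g rv gv≡k))

    ∣r∣≤ : ∣ domain G r ∣ ≤ ∣ honoured G r f ∣ + ∣ honoured G r g ∣
    ∣r∣≤ = ≤-trans (p⊆q⇒∣p∣≤∣q∣ covered) (∣p∪q∣≤∣p∣+∣q∣ (honoured G r f) (honoured G r g))

    [f]or[g] : ∣ honoured G r g ∣ ≤ ∣ honoured G r f ∣ ⊎ ∣ honoured G r f ∣ ≤ ∣ honoured G r g ∣ →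
               IsSatisfiable G (fromℚ ½) L r
    [f]or[g] (inj₁ g≤f) = f , f-proper , d≤m+m⇒½·d≤m ∣ domain G r ∣ ∣ honoured G r f ∣
      (≤-trans ∣r∣≤ (+-monoʳ-≤ ∣ honoured G r f ∣ g≤f))
    [f]or[g] (inj₂ f≤g) = g , g-proper , d≤m+m⇒½·d≤m ∣ domain G r ∣ ∣ honoured G r g ∣
      (≤-trans ∣r∣≤ (+-monoˡ-≤ ∣ honoured G r g ∣ f≤g))

-- Colourings of K₂,ₙ and the lower bounds of one half.

pattern x₁ = zero
pattern x₂ = suc zero
pattern y i = suc (suc i)

module _ {n : ℕ} .{{_ : NonZero n}} where

  colouring : ℕ → ℕ → (Fin n → ℕ) → V (K 2 n) → ℕ
  colouring a b g x₁    = a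
  colouring a b g x₂    = b
  colouring a b g (y i) = g i

  colouring-proper : ∀ L {a b g} →
    a ∈ᶜ L x₁ → b ∈ᶜ L x₂ → (∀ i → g i ∈ᶜ L (y i)) →
    (∀ i → g i ≢ a) → (∀ i → g i ≢ b) →
    IsProperListColouring (K 2 n) L (colouring a b g)
  colouring-proper L a∈ b∈ g∈ g≢a g≢b =
    (λ { x₁ → a∈ ; x₂ → b∈ ; (y i) → g∈ i }) ,
    λ { x₁    (y i) _ → g≢a i ∘ sym
      ; x₂    (y i) _ → g≢b i ∘ sym
      ; (y i) x₁    _ → g≢a i
      ; (y i) x₂    _ → g≢b i
      ; x₁    x₁    ()
      ; x₁    x₂    ()
      ; x₂    x₁    ()
      ; x₂    x₂    ()
      ; (y _) (y _) () }

  3≤t⇒½-flexible : ∀ {t} → 3 ≤ t → IsFlexible (K 2 n) t (fromℚ ½)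
  3≤t⇒½-flexible 3≤t L ∣L∣≡t r (_ , r∈L) =
    let room : ∀ v {m} → m < 3 → m < size (L v)
        room v m<3 = <-≤-trans m<3 (≤-trans 3≤t (≤-reflexive (sym (∣L∣≡t v))))
        -- With nothing forbidden, a request at `x₁` or `x₂` is met outright.
        a , a∈ , _ , a-pref = preferring (L x₁) [] (room x₁ (s≤s z≤n)) (r x₁) (r∈L x₁)
        b , b∈ , _ , b-pref = preferring (L x₂) [] (room x₂ (s≤s z≤n)) (r x₂) (r∈L x₂)
        -- Each new colour avoids both old ones, not just that of its own vertex: this makes the two
        -- forbidden pairs disjoint and uses the third colour of the list.
        a′ , a′∈ , a′∉ = avoiding (L x₁) (a ∷ b ∷ []) (room x₁ ≤-refl)
        b′ , b′∈ , b′∉ = avoiding (L x₂) (a ∷ b ∷ []) (room x₂ ≤-refl)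
        g  = λ i → preferring (L (y i)) (a  ∷ b  ∷ []) (room (y i) ≤-refl) (r (y i)) (r∈L (y i))
        g′ = λ i → preferring (L (y i)) (a′ ∷ b′ ∷ []) (room (y i) ≤-refl) (r (y i)) (r∈L (y i))
        disjoint : ∀ {k} → k ∈ a ∷ b ∷ [] → k ∉ a′ ∷ b′ ∷ []
        disjoint = λ { k∈ (here refl) → a′∉ k∈ ; k∈ (there (here refl)) → b′∉ k∈ }
    in jointlyHonoured⇒½-satisfiable (K 2 n) L r
      (colouring-proper L a∈ b∈ (proj₁ ∘ proj₂ ∘ g)
        (λ i → proj₁ (proj₂ (proj₂ (g i))) ∘ here)
        (λ i → proj₁ (proj₂ (proj₂ (g i))) ∘ there ∘ here))
      (colouring-proper L a′∈ b′∈ (proj₁ ∘ proj₂ ∘ g′)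
        (λ i → proj₁ (proj₂ (proj₂ (g′ i))) ∘ here)
        (λ i → proj₁ (proj₂ (proj₂ (g′ i))) ∘ there ∘ here))
      λ { x₁ k rv → inj₁ (a-pref k rv λ ())
        ; x₂ k rv → inj₁ (b-pref k rv λ ())
        ; (y i) k rv → bestChoices-joint (L (y i)) (g i) (g′ i) disjoint rv }

-- The centre is coloured first here, so each end has a single forbidden colour and lists of size 2
-- leave room.
2≤t⇒½-flexible-K₂₁ : ∀ {t} → 2 ≤ t → IsFlexible (K 2 1) t (fromℚ ½)
2≤t⇒½-flexible-K₂₁ 2≤t L ∣L∣≡t r (_ , r∈L) =
  let room : ∀ v {m} → m < 2 → m < size (L v)
      room v m<2 = <-≤-trans m<2 (≤-trans 2≤t (≤-reflexive (sym (∣L∣≡t v))))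
      choose = λ v c → preferring (L v) (c ∷ []) (room v ≤-refl) (r v) (r∈L v)
      c , c∈ , _ , c-pref =
        preferring (L (y zero)) [] (room (y zero) (s≤s z≤n)) (r (y zero)) (r∈L (y zero))
      c′ , c′∈ , c′∉ = avoiding (L (y zero)) (c ∷ []) (room (y zero) ≤-refl)
      proper : ∀ {k} → k ∈ᶜ L (y zero) → IsProperListColouring (K 2 1) L
                 (colouring (proj₁ (choose x₁ k)) (proj₁ (choose x₂ k)) (λ _ → k))
      proper {k} = λ k∈ → colouring-proper L
        (proj₁ (proj₂ (choose x₁ k))) (proj₁ (proj₂ (choose x₂ k))) (λ { zero → k∈ })
        (λ _ k≡a → proj₁ (proj₂ (proj₂ (choose x₁ k))) (here (sym k≡a)))
        (λ _ k≡b → proj₁ (proj₂ (proj₂ (choose x₂ k))) (here (sym k≡b)))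
      disjoint : ∀ {k} → k ∈ c ∷ [] → k ∉ c′ ∷ []
      disjoint = λ { (here refl) (here c≡c′) → c′∉ (here (sym c≡c′)) }
  in jointlyHonoured⇒½-satisfiable (K 2 1) L r (proper c∈) (proper c′∈)
    λ { x₁ k rv → bestChoices-joint (L x₁) (choose x₁ c) (choose x₁ c′) disjoint rv
      ; x₂ k rv → bestChoices-joint (L x₂) (choose x₂ c) (choose x₂ c′) disjoint rv
      ; (y zero) k rv → inj₁ (c-pref k rv λ ()) }

-- Constant lists and the upper bound of one half.

module _ {n : ℕ} where

  private
    G = K 2 (suc n)

  constantLists : ℕ → ListAssignment G
  constantLists t _ = upTo t , upTo⁺ t

  ¬1-choosable : ¬ IsChoosable G 1
  ¬1-choosable choosable with choosable (constantLists 1) (λ _ → refl)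
  ... | f , f∈ , proper with f x₁ in fx | f (y zero) in fy | f∈ x₁ | f∈ (y zero)
  ... | _ | _ | here refl | here refl = proper x₁ (y zero) tt (trans fx (sym fy))

  edgeRequest : PartialColouring G
  edgeRequest x₁       = just 0
  edgeRequest (y zero) = just 0
  edgeRequest _        = nothing

  ∣edgeRequest∣≡2 : ∣ domain G edgeRequest ∣ ≡ 2
  ∣edgeRequest∣≡2 = cong (2 +_) (∣tabulate-false∣≡0 n)

  edgeRequest-honoured≤1 : ∀ f → f x₁ ≢ f (y zero) → ∣ honoured G edgeRequest f ∣ ≤ 1
  -- Only whether each of these colours is 0 matters; matching on them lets the count compute.
  edgeRequest-honoured≤1 f fx≢fy with f x₁ | f (y zero)
  ... | zero  | zero  = contradiction refl fx≢fy
  ... | zero  | suc _ = ≤-reflexive (cong suc (∣tabulate-false∣≡0 n))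
  ... | suc _ | zero  = ≤-reflexive (cong suc (∣tabulate-false∣≡0 n))
  ... | suc _ | suc _ = ≤-trans (≤-reflexive (∣tabulate-false∣≡0 n)) z≤n

  flexible⇒≤½ : ∀ {t ε} → 1 ≤ t → IsFlexible G t ε → ε ≤ᴿ fromℚ ½
  flexible⇒≤½ {t} {ε} 1≤t flexible =
    let f , (_ , proper) , ε≤ = flexible (constantLists t) (λ _ → length-upTo t)
          edgeRequest ((x₁ , here) , 0∈)
    in ·2≤1⇒≤½ {ε} (edgeRequest-honoured≤1 f (proper x₁ (y zero) tt))
         (subst (λ d → ε · d ≤ ∣ honoured G edgeRequest f ∣) ∣edgeRequest∣≡2 ε≤)
    where
    0∈ : ∀ v k → edgeRequest v ≡ just k → k ∈ upTo t
    0∈ x₁          _ refl = ∈-upTo⁺ 1≤t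
    0∈ (y zero)    _ refl = ∈-upTo⁺ 1≤t
    0∈ x₂          _ ()
    0∈ (y (suc _)) _ ()

-- Lists of size 2 that exclude colours at `x₁`.

pair : ∀ a b → a ≢ b → ColourSet
pair a b a≢b = a ∷ b ∷ [] , (a≢b ∷ []) ∷ [] ∷ []

-- The first four `y i` carry the pairs in {0,1} × {2,3}. Later ones repeat the last pair, so that
-- one assignment serves every size.
crossLists : ∀ {n} → ListAssignment (K 2 (2 + n))
crossLists x₁                         = pair 0 1 λ ()
crossLists x₂                         = pair 2 3 λ ()
crossLists (y zero)                   = pair 0 2 λ ()
crossLists (y (suc zero))             = pair 0 3 λ ()
crossLists (y (suc (suc zero)))       = pair 1 2 λ ()
crossLists (y (suc (suc (suc _))))    = pair 1 3 λ ()

∣crossLists∣≡2 : ∀ {n} v → size (crossLists {n} v) ≡ 2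
∣crossLists∣≡2 x₁                         = refl
∣crossLists∣≡2 x₂                         = refl
∣crossLists∣≡2 (y zero)                   = refl
∣crossLists∣≡2 (y (suc zero))             = refl
∣crossLists∣≡2 (y (suc (suc zero)))       = refl
∣crossLists∣≡2 (y (suc (suc (suc _))))    = refl

-- The colours u and v are forced to be d and e, leaving none for b.
blocked : ∀ {a b u v c d e : ℕ} → a ≡ c → b ∈ d ∷ e ∷ [] → u ∈ c ∷ d ∷ [] → v ∈ c ∷ e ∷ [] →
          a ≢ u → a ≢ v → b ≢ u → b ≢ v → ⊥
blocked refl _ (here refl) _ a≢u _ _ _ = a≢u refl
blocked refl _ _ (here refl) _ a≢v _ _ = a≢v refl
blocked refl (here refl)         (there (here refl)) _ _ _ b≢u _ = b≢u refl
blocked refl (there (here refl)) _ (there (here refl)) _ _ _ b≢v = b≢v refl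

x₁≢0 : ∀ {n f} → IsProperListColouring (K 2 (2 + n)) crossLists f → f x₁ ≢ 0
x₁≢0 (f∈ , proper) fx≡0 =
  blocked fx≡0 (f∈ x₂) (f∈ u) (f∈ v)
    (proper x₁ u tt) (proper x₁ v tt) (proper x₂ u tt) (proper x₂ v tt)
  where u = y zero
        v = y (suc zero)

x₁≢1 : ∀ {n f} → IsProperListColouring (K 2 (4 + n)) crossLists f → f x₁ ≢ 1
x₁≢1 (f∈ , proper) fx≡1 =
  blocked fx≡1 (f∈ x₂) (f∈ u) (f∈ v)
    (proper x₁ u tt) (proper x₁ v tt) (proper x₂ u tt) (proper x₂ v tt)
  where u = y (suc (suc zero))
        v = y (suc (suc (suc zero)))

¬2-choosable : ∀ {n} → ¬ IsChoosable (K 2 (4 + n)) 2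
¬2-choosable choosable with choosable crossLists ∣crossLists∣≡2
... | f , f-proper@(f∈ , _) with f∈ x₁
...   | here fx≡0         = x₁≢0 f-proper fx≡0
...   | there (here fx≡1) = x₁≢1 f-proper fx≡1

module _ {n : ℕ} where

  private
    G = K 2 (2 + n)

  vertexRequest : PartialColouring G
  vertexRequest x₁      = just 0
  vertexRequest (suc _) = nothing

  ∣vertexRequest∣≡1 : ∣ domain G vertexRequest ∣ ≡ 1
  ∣vertexRequest∣≡1 = cong suc (∣tabulate-false∣≡0 n)

  vertexRequest-honoured≡0 : ∀ f → f x₁ ≢ 0 → ∣ honoured G vertexRequest f ∣ ≡ 0
  vertexRequest-honoured≡0 f fx≢0 with f x₁
  ... | zero  = contradiction refl fx≢0
  ... | suc _ = ∣tabulate-false∣≡0 n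

  -- The sole request, colour 0 at `x₁`, is met by no proper colouring from `crossLists`.
  2-flexible⇒≤0 : ∀ {ε} → IsFlexible G 2 ε → ε ≤ᴿ fromℚ 0ℚ
  2-flexible⇒≤0 {ε} flexible =
    let f , f-proper , ε≤ = flexible crossLists ∣crossLists∣≡2
          vertexRequest ((x₁ , here) , λ { x₁ _ refl → here refl ; (suc _) _ () })
    in ·1≤0⇒≤0 {ε} (subst₂ (ε ·_≤_) ∣vertexRequest∣≡1
         (vertexRequest-honoured≡0 f (x₁≢0 f-proper)) ε≤)

-- Values of the flexibility function.

½-flexible⇒½ : ∀ {n t} → 1 ≤ t → IsFlexible (K 2 (suc n)) t (fromℚ ½) →
               IsListEpsilonFlexibility (K 2 (suc n)) t (fromℚ ½)
½-flexible⇒½ 1≤t flexible =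
  ½∈[0,1] , flexible , λ ε _ → flexible⇒≤½ {ε = ε} 1≤t

3≤t⇒½ : ∀ {n t} → 3 ≤ t → IsListEpsilonFlexibility (K 2 (suc n)) t (fromℚ ½)
3≤t⇒½ 3≤t = ½-flexible⇒½ (≤-trans (s≤s z≤n) 3≤t) (3≤t⇒½-flexible 3≤t)

2-choosable⇒0 : ∀ {n} → IsChoosable (K 2 (2 + n)) 2 →
                IsListEpsilonFlexibility (K 2 (2 + n)) 2 (fromℚ 0ℚ)
2-choosable⇒0 {n} choosable =
  0∈[0,1] , choosable⇒0-flexible (K 2 (2 + n)) choosable , λ ε _ → 2-flexible⇒≤0 {ε = ε}

theorem7 : (n : ℕ) .{{_ : NonZero n}} →
    ∀ χ → IsListChromaticNumber (K 2 n) χ →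
    ∀ t → χ ≤ t →
    IsListEpsilonFlexibility (K 2 n) t (fromℚ (
    if (n ≡ᵇ 1) ∧ (2 ≤ᵇ t) then ½
    else if ((n ≡ᵇ 2) ∨ (n ≡ᵇ 3)) ∧ (t ≡ᵇ 2) then 0ℚ
    else ½))
theorem7 (suc n) χ (χ-choosable , _) t χ≤t =
  -- Since one colour per list does not suffice, every `t` in the domain is at least 2.
  cases n t t-choosable (¬choosable⇒< G t-choosable ¬1-choosable)
  where
  G = K 2 (suc n)
  t-choosable = choosable-mono G χ≤t χ-choosable

  -- Both numbers are split far enough for the Boolean conditions in the goal to reduce.
  cases : ∀ n t → IsChoosable (K 2 (suc n)) t → 2 ≤ t →
    IsListEpsilonFlexibility (K 2 (suc n)) t (fromℚ (
    if (suc n ≡ᵇ 1) ∧ (2 ≤ᵇ t) then ½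
    else if ((suc n ≡ᵇ 2) ∨ (suc n ≡ᵇ 3)) ∧ (t ≡ᵇ 2) then 0ℚ
    else ½))
  cases _ 0 _ ()
  cases _ 1 _ (s≤s ())
  cases 0 (suc (suc _)) _ 2≤t = ½-flexible⇒½ (s≤s z≤n) (2≤t⇒½-flexible-K₂₁ 2≤t)
  cases 1 2 choosable _ = 2-choosable⇒0 choosable
  cases 2 2 choosable _ = 2-choosable⇒0 choosable
  -- Four or more `y i`: here 2 lies outside the domain.
  cases (suc (suc (suc _))) 2 choosable _ = contradiction choosable ¬2-choosable
  cases 1 (suc (suc (suc _))) _ _ = 3≤t⇒½ (s≤s (s≤s (s≤s z≤n)))
  cases 2 (suc (suc (suc _))) _ _ = 3≤t⇒½ (s≤s (s≤s (s≤s z≤n)))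
  cases (suc (suc (suc _))) (suc (suc (suc _))) _ _ = 3≤t⇒½ (s≤s (s≤s (s≤s z≤n)))
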